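{- There exist two half-regular bipartite graphs $\mathcal{G}$ and $\mathcal{G}'$ that have the same spectrum, the same degree sequences and the same girth $4$, such that for every $i\in\{6,8,10,12,14,16,18\}$ the number of $i$-cycles in $\mathcal{G}$ is different from the number of $i$-cycles in $\mathcal{G}'$.
   Context: All graphs are finite, simple and undirected. The spectrum of a graph is the multiset of eigenvalues of its adjacency matrix. The degree sequences of a bipartite graph are the two monotonic non-increasing sequences of the node degrees on the two sides of the bipartition. A bipartite graph is bi-regular if all nodes on the same side have the same degree, and irregular if it is not bi-regular. It is half-regular if all nodes on one side of the bipartition have the same degree. Half-regular graphs are regarded as a special case of irregular graphs, so here "half-regular" means half-regular and not bi-regular. An $i$-cycle is a cycle of length $i$, cycles being counted as subgraphs. The girth is the length of a shortest cycle. -}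

module Defs where

open import Level using (0ℓ)
open import Data.Bool using (Bool; true; false; if_then_else_)
import Data.Bool as Bool
open import Data.Fin using (Fin; toℕ)
open import Data.List using (List; map; filter; length; allFin)
import Data.List.Sort as Sort
open import Data.Nat as ℕ using (ℕ; suc; _≤_; _⊔_)
import Data.Nat.Properties as ℕₚ
open import Data.Nat.DivMod using (_mod_)
open import Data.Product using (Σ; ∃; _×_; _,_)
open import Data.Rational as ℚ using (ℚ; 0ℚ; 1ℚ; ½; ∣_∣; _<_)
import Data.Rational.Properties as ℚₚ
open import Data.Rational.Solver using (module +-*-Solver)
open import Data.Sum using (_⊎_)
open import Data.Vec.Functional using (Vector)
open import Algebra.Bundles using (CommutativeRing)
import Algebra.Properties.Semiring.Sum as SemiringSum
open import Function using (_∘_; _⇔_; Bijection; Injective)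
open import Function.Properties.Equivalence using (⇔-isEquivalence)
open import Relation.Binary using (Setoid; IsEquivalence)
import Relation.Binary.Construct.Flip.EqAndOrd as Flip
open import Relation.Binary.PropositionalEquality
  using (_≡_; _≢_; refl; sym; trans; cong; subst; setoid)
open import Relation.Nullary using (¬_; Dec; yes; no)

module RealNumbers where

  -- Two Cauchy sequences represent the same real number when their terms
  -- become arbitrarily close.  Taking the two indices independently makes
  -- x ≋ x the Cauchy condition, and for Cauchy sequences x ≋ y is
  -- equivalent to x n - y n → 0.
  infix 4 _≋_
  _≋_ : (ℕ → ℚ) → (ℕ → ℚ) → Set
  x ≋ y = ∀ ε → 0ℚ < ε →
          ∃ λ N → ∀ m n → N ≤ m → N ≤ n → ∣ x m ℚ.- y n ∣ < ε

  record ℝ : Set where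
    no-eta-equality
    field
      seq    : ℕ → ℚ
      cauchy : seq ≋ seq

  open ℝ public

  infix 4 _≈_
  record _≈_ (x y : ℝ) : Set where
    no-eta-equality
    constructor mk≈
    field
      close : seq x ≋ seq y

  open _≈_ public

  private
    variable
      x y z u v : ℕ → ℚ

    module _ where
      open +-*-Solver

      -‿flip : ∀ p q → ℚ.- (p ℚ.- q) ≡ q ℚ.- p
      -‿flip = solve 2 (λ p q → :- (p :- q) := q :- p) refl

      telescope : ∀ p q r → (p ℚ.- q) ℚ.+ (q ℚ.- r) ≡ p ℚ.- r
      telescope = solve 3 (λ p q r → (p :- q) :+ (q :- r) := p :- r) refl

      +-diff : ∀ p q r s →
               (p ℚ.- r) ℚ.+ (q ℚ.- s) ≡ (p ℚ.+ q) ℚ.- (r ℚ.+ s)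
      +-diff = solve 4 (λ p q r s →
        (p :- r) :+ (q :- s) := (p :+ q) :- (r :+ s)) refl

      *-diff : ∀ p q r s →
               p ℚ.* (q ℚ.- s) ℚ.+ s ℚ.* (p ℚ.- r) ≡ p ℚ.* q ℚ.- r ℚ.* s
      *-diff = solve 4 (λ p q r s →
        p :* (q :- s) :+ s :* (p :- r) := p :* q :- r :* s) refl

      neg-diff : ∀ p q → q ℚ.- p ≡ ℚ.- p ℚ.- ℚ.- q
      neg-diff = solve 2 (λ p q → q :- p := :- p :- :- q) refl

      halves : ∀ p → p ℚ.* ½ ℚ.+ p ℚ.* ½ ≡ p
      halves p = trans (sym (ℚₚ.*-distribˡ-+ p ½ ½)) (ℚₚ.*-identityʳ p)

      split : ∀ p q → p ≡ (p ℚ.- q) ℚ.+ q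
      split = solve 2 (λ p q → p := (p :- q) :+ q) refl

    ∣-∣-sym : ∀ p q → ∣ p ℚ.- q ∣ ≡ ∣ q ℚ.- p ∣
    ∣-∣-sym p q = trans (sym (ℚₚ.∣-p∣≡∣p∣ (p ℚ.- q))) (cong ∣_∣ (-‿flip p q))

    half>0 : ∀ {ε} → 0ℚ < ε → 0ℚ < ε ℚ.* ½
    half>0 {ε} 0<ε = ℚₚ.*-monoˡ-<-pos ½ 0<ε

    sum-< : ∀ {p q δ η} → ∣ p ∣ < δ → ∣ q ∣ < η → ∣ p ℚ.+ q ∣ < δ ℚ.+ η
    sum-< {p} {q} p< q< =
      ℚₚ.≤-<-trans (ℚₚ.∣p+q∣≤∣p∣+∣q∣ p q) (ℚₚ.+-mono-< p< q<)

    ≋-sym : x ≋ y → y ≋ x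
    ≋-sym {x} {y} p ε 0<ε with p ε 0<ε
    ... | N , h = N , λ m n N≤m N≤n →
      subst (_< ε) (∣-∣-sym (x n) (y m)) (h n m N≤n N≤m)

    ≋-trans : x ≋ y → y ≋ z → x ≋ z
    ≋-trans {x} {y} {z} p q ε 0<ε
      with p (ε ℚ.* ½) (half>0 0<ε) | q (ε ℚ.* ½) (half>0 0<ε)
    ... | M , f | N , g = (M ⊔ N) , λ m n ≤m ≤n →
      let k = M ⊔ N in
      subst (λ d → ∣ d ∣ < ε) (telescope (x m) (y k) (z n))
        (subst (∣ (x m ℚ.- y k) ℚ.+ (y k ℚ.- z n) ∣ <_) (halves ε)
          (sum-< {x m ℚ.- y k} {y k ℚ.- z n}
            (f m k (ℕₚ.m⊔n≤o⇒m≤o M N ≤m) (ℕₚ.m≤m⊔n M N))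
            (g k n (ℕₚ.m≤n⊔m M N) (ℕₚ.m⊔n≤o⇒n≤o M N ≤n))))

    ≋-neg : x ≋ y → (ℚ.-_ ∘ x) ≋ (ℚ.-_ ∘ y)
    ≋-neg {x} {y} p ε 0<ε with p ε 0<ε
    ... | N , h = N , λ m n N≤m N≤n →
      subst (_< ε)
        (trans (∣-∣-sym (x m) (y n)) (cong ∣_∣ (neg-diff (x m) (y n))))
        (h m n N≤m N≤n)

    ≋-+ : x ≋ y → u ≋ v → (λ n → x n ℚ.+ u n) ≋ (λ n → y n ℚ.+ v n)
    ≋-+ {x} {y} {u} {v} p q ε 0<ε
      with p (ε ℚ.* ½) (half>0 0<ε) | q (ε ℚ.* ½) (half>0 0<ε)
    ... | M , f | N , g = (M ⊔ N) , λ m n ≤m ≤n →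
      subst (λ d → ∣ d ∣ < ε) (+-diff (x m) (u m) (y n) (v n))
        (subst (∣ (x m ℚ.- y n) ℚ.+ (u m ℚ.- v n) ∣ <_) (halves ε)
          (sum-< {x m ℚ.- y n} {u m ℚ.- v n}
            (f m n (ℕₚ.m⊔n≤o⇒m≤o M N ≤m) (ℕₚ.m⊔n≤o⇒m≤o M N ≤n))
            (g m n (ℕₚ.m⊔n≤o⇒n≤o M N ≤m) (ℕₚ.m⊔n≤o⇒n≤o M N ≤n))))

    EventuallyBounded : (ℕ → ℚ) → Set
    EventuallyBounded x =
      ∃ λ B → 0ℚ < B × ∃ λ N → ∀ n → N ≤ n → ∣ x n ∣ < B

    bounded : x ≋ x → EventuallyBounded x
    bounded {x} p with p 1ℚ (ℚₚ.positive⁻¹ 1ℚ)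
    ... | N , h = 1ℚ ℚ.+ ∣ x N ∣
                , ℚₚ.<-≤-trans (ℚₚ.positive⁻¹ 1ℚ)
                    (subst (ℚ._≤ 1ℚ ℚ.+ ∣ x N ∣) (ℚₚ.+-identityʳ 1ℚ)
                      (ℚₚ.+-monoʳ-≤ 1ℚ (ℚₚ.0≤∣p∣ (x N))))
                , N , λ n N≤n →
      subst (λ d → ∣ d ∣ < 1ℚ ℚ.+ ∣ x N ∣) (sym (split (x n) (x N)))
        (ℚₚ.≤-<-trans (ℚₚ.∣p+q∣≤∣p∣+∣q∣ (x n ℚ.- x N) (x N))
          (ℚₚ.+-monoˡ-< ∣ x N ∣ (h n N N≤n ℕₚ.≤-refl)))

    prod-< : ∀ {p q B δ} → ∣ p ∣ < B → ∣ q ∣ < δ → 0ℚ < B →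
             ∣ p ℚ.* q ∣ < B ℚ.* δ
    prod-< {p} {q} {B} {δ} p<B q<δ 0<B =
      subst (_< B ℚ.* δ) (sym (ℚₚ.∣p*q∣≡∣p∣*∣q∣ p q))
        (ℚₚ.≤-<-trans
          (ℚₚ.*-monoʳ-≤-nonNeg ∣ q ∣ {{ℚₚ.∣-∣-nonNeg q}} (ℚₚ.<⇒≤ p<B))
          (ℚₚ.*-monoʳ-<-pos B {{ℚ.positive 0<B}} q<δ))

    divide : ∀ K ε → 0ℚ < K → 0ℚ < ε → ∃ λ δ → 0ℚ < δ × K ℚ.* δ ≡ ε
    divide K ε 0<K 0<ε = K⁻¹ ℚ.* ε , pos , eq
      where
      instance
        K-pos = ℚ.positive 0<K
        ε-pos = ℚ.positive 0<ε
        K-nz  = ℚₚ.pos⇒nonZero K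
      K⁻¹ = ℚ.1/ K
      pos : 0ℚ < K⁻¹ ℚ.* ε
      pos = ℚₚ.positive⁻¹ _ {{ℚₚ.pos*pos⇒pos K⁻¹ {{ℚₚ.1/pos⇒pos K}} ε}}
      eq : K ℚ.* (K⁻¹ ℚ.* ε) ≡ ε
      eq = trans (sym (ℚₚ.*-assoc K K⁻¹ ε))
             (trans (cong (ℚ._* ε) (ℚₚ.*-inverseʳ K)) (ℚₚ.*-identityˡ ε))

    product-estimate : ∀ {p q r t B C δ} → 0ℚ < B → 0ℚ < C →
      ∣ p ∣ < B → ∣ t ∣ < C → ∣ p ℚ.- r ∣ < δ → ∣ q ℚ.- t ∣ < δ →
      ∣ p ℚ.* q ℚ.- r ℚ.* t ∣ < (B ℚ.+ C) ℚ.* δ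
    product-estimate {p} {q} {r} {t} {B} {C} {δ} 0<B 0<C p<B t<C p-r q-t =
      subst (_< (B ℚ.+ C) ℚ.* δ) (cong ∣_∣ (*-diff p q r t))
        (subst (∣ p ℚ.* (q ℚ.- t) ℚ.+ t ℚ.* (p ℚ.- r) ∣ <_)
          (sym (ℚₚ.*-distribʳ-+ δ B C))
          (sum-< {p ℚ.* (q ℚ.- t)} {t ℚ.* (p ℚ.- r)} {B ℚ.* δ} {C ℚ.* δ}
            (prod-< {p} {q ℚ.- t} {B} {δ} p<B q-t 0<B)
            (prod-< {t} {p ℚ.- r} {C} {δ} t<C p-r 0<C)))

    ≋-* : x ≋ x → v ≋ v → x ≋ y → u ≋ v →
          (λ n → x n ℚ.* u n) ≋ (λ n → y n ℚ.* v n)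
    ≋-* {x} {v} {y} {u} cx cv p q ε 0<ε =
      let (B , 0<B , K , x<B) = bounded cx
          (C , 0<C , L , v<C) = bounded cv
          (δ , 0<δ , eq) = divide (B ℚ.+ C) ε (ℚₚ.+-mono-< 0<B 0<C) 0<ε
          (M , f) = p δ 0<δ
          (N , g) = q δ 0<δ
      in (K ⊔ L) ⊔ (M ⊔ N) , λ m n ≤m ≤n →
      let KLm = ℕₚ.m⊔n≤o⇒m≤o (K ⊔ L) (M ⊔ N) ≤m
          KLn = ℕₚ.m⊔n≤o⇒m≤o (K ⊔ L) (M ⊔ N) ≤n
          MNm = ℕₚ.m⊔n≤o⇒n≤o (K ⊔ L) (M ⊔ N) ≤m
          MNn = ℕₚ.m⊔n≤o⇒n≤o (K ⊔ L) (M ⊔ N) ≤n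
      in
      subst (∣ x m ℚ.* u m ℚ.- y n ℚ.* v n ∣ <_) eq
        (product-estimate {x m} {u m} {y n} {v n} {B} {C} {δ} 0<B 0<C
          (x<B m (ℕₚ.m⊔n≤o⇒m≤o K L KLm))
          (v<C n (ℕₚ.m⊔n≤o⇒n≤o K L KLn))
          (f m n (ℕₚ.m⊔n≤o⇒m≤o M N MNm) (ℕₚ.m⊔n≤o⇒m≤o M N MNn))
          (g m n (ℕₚ.m⊔n≤o⇒n≤o M N MNm) (ℕₚ.m⊔n≤o⇒n≤o M N MNn)))

  infixl 6 _+_
  infixl 7 _*_
  infix  8 -_

  _+_ _*_ : ℝ → ℝ → ℝ
  (x + y) .seq n  = seq x n ℚ.+ seq y n
  (x + y) .cauchy =
    ≋-+ {seq x} {seq x} {seq y} {seq y} (cauchy x) (cauchy y)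
  (x * y) .seq n  = seq x n ℚ.* seq y n
  (x * y) .cauchy =
    ≋-* {seq x} {seq y} {seq x} {seq y}
      (cauchy x) (cauchy y) (cauchy x) (cauchy y)

  -_ : ℝ → ℝ
  (- x) .seq n  = ℚ.- seq x n
  (- x) .cauchy = ≋-neg {seq x} {seq x} (cauchy x)

  fromℚ : ℚ → ℝ
  fromℚ q .seq _ = q
  fromℚ q .cauchy ε 0<ε = 0 , λ _ _ _ _ →
    subst (λ d → ∣ d ∣ < ε) (sym (ℚₚ.+-inverseʳ q)) 0<ε

  0ℝ 1ℝ : ℝ
  0ℝ = fromℚ 0ℚ
  1ℝ = fromℚ 1ℚ

  ≗⇒≈ : ∀ {x y} → (∀ n → seq x n ≡ seq y n) → x ≈ y
  ≗⇒≈ {x} {y} eq = mk≈ λ ε 0<ε →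
    let (N , h) = cauchy x ε 0<ε in
    N , λ m n N≤m N≤n →
      subst (λ d → ∣ seq x m ℚ.- d ∣ < ε) (eq n) (h m n N≤m N≤n)

  ≈-isEquivalence : IsEquivalence _≈_
  ≈-isEquivalence = record
    { refl  = λ {x} → mk≈ (cauchy x)
    ; sym   = λ {x} {y} p → mk≈ (≋-sym {seq x} {seq y} (close p))
    ; trans = λ {x} {y} {z} p q →
        mk≈ (≋-trans {seq x} {seq y} {seq z} (close p) (close q))
    }

  +-cong : ∀ {x y u v} → x ≈ y → u ≈ v → x + u ≈ y + v
  +-cong {x} {y} {u} {v} p q =
    mk≈ (≋-+ {seq x} {seq y} {seq u} {seq v} (close p) (close q))

  *-cong : ∀ {x y u v} → x ≈ y → u ≈ v → x * u ≈ y * v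
  *-cong {x} {y} {u} {v} p q =
    mk≈ (≋-* {seq x} {seq v} {seq y} {seq u}
          (cauchy x) (cauchy v) (close p) (close q))

  -‿cong : ∀ {x y} → x ≈ y → - x ≈ - y
  -‿cong {x} {y} p = mk≈ (≋-neg {seq x} {seq y} (close p))

  +-assoc : ∀ x y z → (x + y) + z ≈ x + (y + z)
  +-assoc x y z = ≗⇒≈ λ n → ℚₚ.+-assoc (seq x n) (seq y n) (seq z n)

  *-assoc : ∀ x y z → (x * y) * z ≈ x * (y * z)
  *-assoc x y z = ≗⇒≈ λ n → ℚₚ.*-assoc (seq x n) (seq y n) (seq z n)

  distribˡ : ∀ x y z → x * (y + z) ≈ (x * y) + (x * z)
  distribˡ x y z = ≗⇒≈ λ n → ℚₚ.*-distribˡ-+ (seq x n) (seq y n) (seq z n)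

  distribʳ : ∀ x y z → (y + z) * x ≈ (y * x) + (z * x)
  distribʳ x y z = ≗⇒≈ λ n → ℚₚ.*-distribʳ-+ (seq x n) (seq y n) (seq z n)

  +-identityˡ : ∀ x → 0ℝ + x ≈ x
  +-identityˡ x = ≗⇒≈ λ n → ℚₚ.+-identityˡ (seq x n)

  +-identityʳ : ∀ x → x + 0ℝ ≈ x
  +-identityʳ x = ≗⇒≈ λ n → ℚₚ.+-identityʳ (seq x n)

  *-identityˡ : ∀ x → 1ℝ * x ≈ x
  *-identityˡ x = ≗⇒≈ λ n → ℚₚ.*-identityˡ (seq x n)

  *-identityʳ : ∀ x → x * 1ℝ ≈ x
  *-identityʳ x = ≗⇒≈ λ n → ℚₚ.*-identityʳ (seq x n)

  +-inverseˡ : ∀ x → (- x) + x ≈ 0ℝ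
  +-inverseˡ x = ≗⇒≈ λ n → ℚₚ.+-inverseˡ (seq x n)

  +-inverseʳ : ∀ x → x + (- x) ≈ 0ℝ
  +-inverseʳ x = ≗⇒≈ λ n → ℚₚ.+-inverseʳ (seq x n)

  +-comm : ∀ x y → x + y ≈ y + x
  +-comm x y = ≗⇒≈ λ n → ℚₚ.+-comm (seq x n) (seq y n)

  *-comm : ∀ x y → x * y ≈ y * x
  *-comm x y = ≗⇒≈ λ n → ℚₚ.*-comm (seq x n) (seq y n)

  ℝ-commutativeRing : CommutativeRing 0ℓ 0ℓ
  ℝ-commutativeRing = record
    { Carrier = ℝ
    ; _≈_     = _≈_
    ; _+_     = _+_
    ; _*_     = _*_
    ; -_      = -_
    ; 0#      = 0ℝ
    ; 1#      = 1ℝ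
    ; isCommutativeRing = record
      { isRing = record
        { +-isAbelianGroup = record
          { isGroup = record
            { isMonoid = record
              { isSemigroup = record
                { isMagma = record
                  { isEquivalence = ≈-isEquivalence
                  ; ∙-cong        = +-cong
                  }
                ; assoc = +-assoc
                }
              ; identity = +-identityˡ , +-identityʳ
              }
            ; inverse = +-inverseˡ , +-inverseʳ
            ; ⁻¹-cong = -‿cong
            }
          ; comm = +-comm
          }
        ; *-cong     = *-cong
        ; *-assoc    = *-assoc
        ; *-identity = *-identityˡ , *-identityʳ
        ; distrib    = distribˡ , distribʳ
        }
      ; *-comm = *-comm
      }
    }

open RealNumbers using (ℝ; _≈_; _+_; _*_; 0ℝ; 1ℝ; ℝ-commutativeRing)
open SemiringSum (CommutativeRing.semiring ℝ-commutativeRing)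
  using (sum-syntax)

Matrix : ℕ → Set
Matrix n = Fin n → Fin n → ℝ

InEigenspace : ∀ {n} → Matrix n → ℝ → Vector ℝ n → Set
InEigenspace {n} A ev v = ∀ i → ∑[ j < n ] (A i j * v j) ≈ ev * v i

LinearlyIndependent : ∀ {m n} → Vector (Vector ℝ n) m → Set
LinearlyIndependent {m} b =
  ∀ (c : Vector ℝ m) → (∀ i → ∑[ k < m ] (c k * b k i) ≈ 0ℝ) → ∀ k → c k ≈ 0ℝ

-- The dimension of the eigenspace of A for ev is m.  For a real symmetric
-- matrix this is the multiplicity of ev in the multiset of eigenvalues; it
-- is 0 exactly when ev is not an eigenvalue.
record EigenvalueMultiplicity {n} (A : Matrix n) (ev : ℝ) (m : ℕ) : Set where
  field
    basis       : Vector (Vector ℝ n) m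
    eigen       : ∀ k → InEigenspace A ev (basis k)
    independent : LinearlyIndependent basis
    spanning    : ∀ v → InEigenspace A ev v →
                  Σ (Vector ℝ m) λ c → ∀ i → v i ≈ ∑[ k < m ] (c k * basis k i)

record Graph : Set where
  field
    order  : ℕ
    adj    : Fin order → Fin order → Bool
    symm   : ∀ u v → adj u v ≡ adj v u
    irrefl : ∀ v → adj v v ≡ false

  Vertex : Set
  Vertex = Fin order

  Adjacent : Vertex → Vertex → Set
  Adjacent u v = adj u v ≡ true

  degree : Vertex → ℕ
  degree v = length (filter (λ u → adj v u Bool.≟ true) (allFin order))

  adjacencyMatrix : Matrix order
  adjacencyMatrix u v = if adj u v then 1ℝ else 0ℝ

-- Equality of the multisets of eigenvalues: every real number has the same
-- multiplicity in both.  (All eigenvalues of a symmetric matrix are real.)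
SameSpectrum : Graph → Graph → Set
SameSpectrum G H = ∀ (ev : ℝ) (m : ℕ) →
  EigenvalueMultiplicity (Graph.adjacencyMatrix G) ev m ⇔
  EigenvalueMultiplicity (Graph.adjacencyMatrix H) ev m

next : ∀ {k} → Fin k → Fin k
next {suc k} i = suc (toℕ i) mod suc k

-- A cyclic traversal of a k-cycle.  Each cycle subgraph has 2k of these,
-- which SameCycle identifies.
record Cycle (G : Graph) (k : ℕ) : Set where
  open Graph G
  field
    3≤k       : 3 ≤ k
    vertex    : Fin k → Vertex
    injective : Injective _≡_ _≡_ vertex
    adjacent  : ∀ i → Adjacent (vertex i) (vertex (next i))

  HasEdge : Vertex → Vertex → Set
  HasEdge u v = ∃ λ i → (u ≡ vertex i × v ≡ vertex (next i))
                      ⊎ (v ≡ vertex i × u ≡ vertex (next i))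

-- Equality as subgraphs; the edges of a cycle determine its vertices.
SameCycle : ∀ {G k} → Cycle G k → Cycle G k → Set
SameCycle c d = ∀ u v → Cycle.HasEdge c u v ⇔ Cycle.HasEdge d u v

cycleSetoid : Graph → ℕ → Setoid 0ℓ 0ℓ
cycleSetoid G k = record
  { Carrier       = Cycle G k
  ; _≈_           = SameCycle
  ; isEquivalence = record
    { refl  = λ u v → IsEquivalence.refl ⇔-isEquivalence
    ; sym   = λ p u v → IsEquivalence.sym ⇔-isEquivalence (p u v)
    ; trans = λ p q u v → IsEquivalence.trans ⇔-isEquivalence (p u v) (q u v)
    }
  }

CycleCount : Graph → ℕ → ℕ → Set
CycleCount G k N = Bijection (setoid (Fin N)) (cycleSetoid G k)

Girth : Graph → ℕ → Set
Girth G g = Cycle G g × (∀ k → Cycle G k → g ≤ k)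

data Side : Set where
  left right : Side

_≟ˢ_ : (s t : Side) → Dec (s ≡ t)
left  ≟ˢ left  = yes refl
left  ≟ˢ right = no λ ()
right ≟ˢ left  = no λ ()
right ≟ˢ right = yes refl

open Sort (Flip.decTotalOrder ℕₚ.≤-decTotalOrder)
  using () renaming (sort to sortNonIncreasing)

record BipartiteGraph : Set where
  field
    graph : Graph
  open Graph graph public
  field
    side      : Vertex → Side
    bipartite : ∀ u v → Adjacent u v → side u ≢ side v

  degreeSequence : Side → List ℕ
  degreeSequence s =
    sortNonIncreasing (map degree (filter (λ v → side v ≟ˢ s) (allFin order)))

  RegularOn : Side → Set
  RegularOn s = ∀ u v → side u ≡ s → side v ≡ s → degree u ≡ degree v

  BiRegular : Set
  BiRegular = ∀ s → RegularOn s

  HalfRegular : Set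
  HalfRegular = (∃ λ s → RegularOn s) × ¬ BiRegular

SameDegreeSequences : BipartiteGraph → BipartiteGraph → Set
SameDegreeSequences G H =
  ∀ s → BipartiteGraph.degreeSequence G s ≡ BipartiteGraph.degreeSequence H s

{-# OPTIONS --safe #-}
module Submission where

-- A bipartite graph all of whose left vertices have degree 2 is the subdivision
-- of a multigraph on its right vertices; its 2k-cycles are the k-cycles of the
-- multigraph, a pair of parallel edges being a 2-cycle.  Take such a graph G on
-- 9 + 13 vertices.  Switching three cells of four vertices (four nodes and two
-- quadruples of edges) in the manner of Godsil and McKay, that is, conjugating
-- the adjacency matrix with the involution T which is ½J - I on each cell and
-- the identity elsewhere, turns it into that of another subdivision G′.  So the
-- spectra agree, while the pair of parallel edges moves from the nodes 1, 6 to
-- the nodes 0, 6 and all the longer cycle counts change.  Cycles are counted by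
-- listing one traversal of each: the one which starts at the least vertex and
-- whose second vertex is less than its last.

open import Defs
open import Algebra.Bundles using (CommutativeRing)
import Algebra.Properties.Semiring.Sum as SemiringSum
open import Data.Bool using (Bool; true; false; if_then_else_; _∨_)
import Data.Bool as Bool
open import Data.Fin using (Fin; zero; suc; toℕ; splitAt; punchIn; #_)
import Data.Fin as Fin
import Data.Fin.Properties as Finₚ
open import Data.Integer as ℤ using (ℤ; 0ℤ; 1ℤ)
import Data.Integer.Properties as ℤₚ
open import Data.List using (List; []; _∷_; map; concatMap; filter; allFin; length)
import Data.List as List
import Data.List.Membership.DecPropositional as DecMembership
open import Data.List.Membership.Propositional using (_∈_)
open import Data.List.Membership.Propositional.Properties
  using (∈-map⁺; ∈-filter⁺; ∈-concatMap⁺; ∈-allFin)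
open import Data.List.Relation.Binary.Permutation.Propositional
  using (_↭_; ↭⇒↭ₛ; ↭-refl; ↭-sym; ↭-trans; prep; swap)
open import Data.List.Relation.Binary.Pointwise using (Pointwise-≡⇒≡)
open import Data.List.Relation.Unary.All using (All; []; _∷_)
import Data.List.Relation.Unary.All as All
open import Data.List.Relation.Unary.All.Properties using (All¬⇒¬Any)
open import Data.List.Relation.Unary.Any using (here; index)
import Data.List.Relation.Unary.Any as Any
open import Data.List.Relation.Unary.Any.Properties using (lookup-index)
open import Data.List.Relation.Unary.Sorted.TotalOrder.Properties using (↗↭↗⇒≋)
import Data.List.Sort as Sort
open import Data.Nat using (ℕ; zero; suc)
import Data.Nat as Nat
open import Data.Nat.Divisibility using (_∣_; divides; ∣⇒≤; ∣m+n∣m⇒∣n)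
open import Data.Nat.DivMod
  using (_mod_; m%n<n; m<n⇒m%n≡m; m≡m%n+[m/n]*n; %-distribˡ-+; m%n%n≡m%n; [m+n]%n≡m%n)
import Data.Nat.Properties as ℕₚ
open import Data.Nat.Solver using (module +-*-Solver)
open import Data.Product using (∃; _×_; _,_; proj₁; proj₂)
open import Data.Rational as ℚ using (½)
import Data.Rational.Properties as ℚₚ
import Data.Rational.Unnormalised as ℚᵘ
import Data.Rational.Unnormalised.Properties as ℚᵘₚ
open import Data.Sum using (_⊎_; inj₁; inj₂; [_,_]′)
open import Data.Vec using (Vec; []; _∷_; lookup)
open import Data.Vec.Functional using (Vector)
open import Function using (_∘_; _⇔_; mk⇔; Bijection; Equivalence)
open import Relation.Binary using (Setoid; DecTotalOrder; tri<; tri≈; tri>)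
import Relation.Binary.Construct.Flip.EqAndOrd as Flip
open import Relation.Binary.PropositionalEquality as ≡
  using (_≡_; _≢_; _≗_; cong; subst; subst₂; module ≡-Reasoning)
import Relation.Binary.Reasoning.Setoid as SetoidReasoning
open import Relation.Nullary using (¬_; Dec; does; contradiction; ¬?)
open import Relation.Nullary.Decidable
  using (_×-dec_; _⊎-dec_; _→-dec_; True; toWitness; from-yes; dec-true; dec-false)
open BipartiteGraph using (graph; HalfRegular)

-- Traversals of cycles

module CycleCounting where
  open Nat using (_+_; _*_; _%_; _/_; _≤_; _<_; z≤n; s≤s)
  open ≡ using (refl; sym; trans)

  -- Indices modulo the length of a cycle.

  toℕ-mod : ∀ n k → toℕ (n mod suc k) ≡ n % suc k
  toℕ-mod n k = Finₚ.toℕ-fromℕ< (m%n<n n (suc k))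

  suc-% : ∀ n k → suc (n % suc k) % suc k ≡ suc n % suc k
  suc-% n k = begin
    suc (n % suc k) % suc k                          ≡⟨ %-distribˡ-+ 1 (n % suc k) (suc k) ⟩
    (1 % suc k + n % suc k % suc k) % suc k
      ≡⟨ cong (λ x → (1 % suc k + x) % suc k) (m%n%n≡m%n n (suc k)) ⟩
    (1 % suc k + n % suc k) % suc k                  ≡⟨ %-distribˡ-+ 1 n (suc k) ⟨
    suc n % suc k                                    ∎
    where open ≡-Reasoning

  next-mod : ∀ n k → next (n mod suc k) ≡ suc n mod suc k
  next-mod n k = Finₚ.toℕ-injective (begin
    toℕ (suc (toℕ (n mod suc k)) mod suc k)  ≡⟨ toℕ-mod (suc (toℕ (n mod suc k))) k ⟩
    suc (toℕ (n mod suc k)) % suc k          ≡⟨ cong (λ x → suc x % suc k) (toℕ-mod n k) ⟩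
    suc (n % suc k) % suc k                  ≡⟨ suc-% n k ⟩
    suc n % suc k                            ≡⟨ toℕ-mod (suc n) k ⟨
    toℕ (suc n mod suc k)                    ∎)
    where open ≡-Reasoning

  toℕ-mod-id : ∀ {k} (i : Fin (suc k)) → toℕ i mod suc k ≡ i
  toℕ-mod-id {k} i =
    Finₚ.toℕ-injective (trans (toℕ-mod (toℕ i) k) (m<n⇒m%n≡m (Finₚ.toℕ<n i)))

  -- If the remainders agreed, cancelling them from the two divisions with remainder would make
  -- `suc k` divide `n / suc k * suc k + d`, hence `d`, which lies strictly between 0 and `suc k`.
  %-apart : ∀ k n d → 0 < d → d < suc k → n % suc k ≢ (n + d) % suc k
  %-apart k n (suc d) _ d<k eq = ℕₚ.<⇒≱ d<k (∣⇒≤ (∣m+n∣m⇒∣n k∣ (divides (n / suc k) refl)))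
    where
    open ≡-Reasoning
    k∣ : suc k ∣ n / suc k * suc k + suc d
    k∣ = divides ((n + suc d) / suc k) (ℕₚ.+-cancelˡ-≡ (n % suc k) _ _ (begin
      n % suc k + (n / suc k * suc k + suc d)  ≡⟨ ℕₚ.+-assoc (n % suc k) _ _ ⟨
      n % suc k + n / suc k * suc k + suc d    ≡⟨ cong (_+ suc d) (m≡m%n+[m/n]*n n (suc k)) ⟨
      n + suc d                                ≡⟨ m≡m%n+[m/n]*n (n + suc d) (suc k) ⟩
      (n + suc d) % suc k + (n + suc d) / suc k * suc k
        ≡⟨ cong (_+ (n + suc d) / suc k * suc k) eq ⟨
      n % suc k + (n + suc d) / suc k * suc k  ∎))

  argmin : (h : ℕ → ℕ) → ∀ m → ∃ λ r → ∀ n → n ≤ m → h r ≤ h n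
  argmin h zero    = 0 , λ { zero _ → ℕₚ.≤-refl }
  argmin h (suc m) with argmin h m
  ... | r , least with ℕₚ.≤-total (h r) (h (suc m))
  ...   | inj₁ r≤ = r , λ n n≤ → [ (λ n< → least n (ℕₚ.≤-pred n<)) , (λ { refl → r≤ }) ]′
                                   (ℕₚ.m≤n⇒m<n∨m≡n n≤)
  ...   | inj₂ ≤r = suc m , λ n n≤ → [ (λ n< → ℕₚ.≤-trans ≤r (least n (ℕₚ.≤-pred n<)))
                                     , (λ { refl → ℕₚ.≤-refl }) ]′ (ℕₚ.m≤n⇒m<n∨m≡n n≤)

  -- Inclusion of edge sets of traversals.

  infix 4 _⊑_
  -- Inclusion of the undirected edges passed by two infinite walks. For tours of cycles, inclusion
  -- both ways is equality of subgraphs, insensitive to starting point and direction.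
  _⊑_ : {A : Set} → (ℕ → A) → (ℕ → A) → Set
  p ⊑ q = ∀ n → ∃ λ m → (p n ≡ q m × p (suc n) ≡ q (suc m))
                      ⊎ (p n ≡ q (suc m) × p (suc n) ≡ q m)

  module _ {A : Set} {p q r : ℕ → A} where

    ⊑-trans : p ⊑ q → q ⊑ r → p ⊑ r
    ⊑-trans s t n with s n
    ... | m , e with t m
    ...   | l , f = l , join e f
      where
      join : _ → _ → _
      join (inj₁ (a , b)) (inj₁ (c , d)) = inj₁ (trans a c , trans b d)
      join (inj₁ (a , b)) (inj₂ (c , d)) = inj₂ (trans a c , trans b d)
      join (inj₂ (a , b)) (inj₁ (c , d)) = inj₂ (trans a d , trans b c)
      join (inj₂ (a , b)) (inj₂ (c , d)) = inj₁ (trans a d , trans b c)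

  ≗⇒⊑ : {A : Set} {p q : ℕ → A} → p ≗ q → p ⊑ q
  ≗⇒⊑ eq n = n , inj₁ (eq n , eq (suc n))

  segment : {A : Set} → (ℕ → A) → ℕ → ∀ n → Vec A n
  segment p i zero    = []
  segment p i (suc n) = p i ∷ segment p (suc i) n

  lookup-segment : ∀ {A : Set} (p : ℕ → A) i {n} (j : Fin n) →
                   lookup (segment p i n) j ≡ p (i + toℕ j)
  lookup-segment p i zero    = cong p (sym (ℕₚ.+-identityʳ i))
  lookup-segment p i (suc j) =
    trans (lookup-segment p (suc i) j) (cong p (sym (ℕₚ.+-suc i (toℕ j))))

  module Cycles (G : Graph) where
    open Graph G

    -- A cycle of length suc m traversed forever, indexed by ℕ so that rotations
    -- and reversals are reindexings.
    record Tour (m : ℕ) : Set where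
      field
        at       : ℕ → Vertex
        step     : ∀ n → Adjacent (at n) (at (suc n))
        periodic : ∀ n → at (n + suc m) ≡ at n
        apart    : ∀ n d → 0 < d → d < suc m → at n ≢ at (n + d)

      periodic* : ∀ n j → at (n + j * suc m) ≡ at n
      periodic* n zero    = cong at (ℕₚ.+-identityʳ n)
      periodic* n (suc j) = begin
        at (n + (suc m + j * suc m))  ≡⟨ cong (λ x → at (n + x)) (ℕₚ.+-comm (suc m) _) ⟩
        at (n + (j * suc m + suc m))  ≡⟨ cong at (ℕₚ.+-assoc n _ _) ⟨
        at (n + j * suc m + suc m)    ≡⟨ periodic _ ⟩
        at (n + j * suc m)            ≡⟨ periodic* n j ⟩
        at n                          ∎
        where open ≡-Reasoning

      at-% : ∀ n → at (n % suc m) ≡ at n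
      at-% n = trans (sym (periodic* (n % suc m) (n / suc m)))
                     (cong at (sym (m≡m%n+[m/n]*n n (suc m))))

    open Tour

    adjacent-sym : ∀ {u v} → Adjacent u v → Adjacent v u
    adjacent-sym {u} {v} uv = trans (symm v u) uv

    tour : ∀ {m} → Cycle G (suc m) → Tour m
    tour {m} c = record
      { at       = λ n → vertex (n mod suc m)
      ; step     = λ n → subst (λ i → Adjacent (vertex (n mod suc m)) (vertex i))
                               (next-mod n m) (adjacent (n mod suc m))
      ; periodic = λ n → cong vertex (Finₚ.toℕ-injective
                     (trans (toℕ-mod (n + suc m) m)
                       (trans ([m+n]%n≡m%n n (suc m)) (sym (toℕ-mod n m)))))
      ; apart    = λ n d 0<d d<k eq → %-apart m n d 0<d d<k
                     (trans (sym (toℕ-mod n m))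
                       (trans (cong toℕ (injective eq)) (toℕ-mod (n + d) m)))
      }
      where open Cycle c

    ⊑⇒HasEdge : ∀ {m} (c d : Cycle G (suc m)) → at (tour c) ⊑ at (tour d) →
                ∀ u v → Cycle.HasEdge c u v → Cycle.HasEdge d u v
    ⊑⇒HasEdge {m} c d c⊑d u v (i , e) with c⊑d (toℕ i)
    ... | n , f = n mod suc m , join e f
      where
      open Cycle
      i≡ : vertex c i ≡ at (tour c) (toℕ i)
      i≡ = cong (vertex c) (sym (toℕ-mod-id i))
      n≡ : at (tour d) (suc n) ≡ vertex d (next (n mod suc m))
      n≡ = cong (vertex d) (sym (next-mod n m))
      join : _ → _ → _
      join (inj₁ (a , b)) (inj₁ (x , y)) = inj₁ (trans a (trans i≡ x) , trans b (trans y n≡))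
      join (inj₁ (a , b)) (inj₂ (x , y)) = inj₂ (trans b y , trans a (trans i≡ (trans x n≡)))
      join (inj₂ (a , b)) (inj₁ (x , y)) = inj₂ (trans a (trans i≡ x) , trans b (trans y n≡))
      join (inj₂ (a , b)) (inj₂ (x , y)) = inj₁ (trans b y , trans a (trans i≡ (trans x n≡)))

    ⊑⇒SameCycle : ∀ {m} (c d : Cycle G (suc m)) →
                  at (tour c) ⊑ at (tour d) → at (tour d) ⊑ at (tour c) → SameCycle c d
    ⊑⇒SameCycle c d c⊑d d⊑c u v = mk⇔ (⊑⇒HasEdge c d c⊑d u v) (⊑⇒HasEdge d c d⊑c u v)

    rotate : ∀ {m} → ℕ → Tour m → Tour m
    rotate r t = record
      { at       = λ n → at t (r + n)
      ; step     = λ n → subst (λ x → Adjacent (at t (r + n)) (at t x))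
                               (sym (ℕₚ.+-suc r n)) (step t (r + n))
      ; periodic = λ n → trans (cong (at t) (sym (ℕₚ.+-assoc r n _))) (periodic t (r + n))
      ; apart    = λ n d 0<d d<k eq → apart t (r + n) d 0<d d<k
                     (trans eq (cong (at t) (sym (ℕₚ.+-assoc r n d))))
      }

    rotate-⊑ : ∀ {m} r (t : Tour m) → at (rotate r t) ⊑ at t
    rotate-⊑ r t n = r + n , inj₁ (refl , cong (at t) (ℕₚ.+-suc r n))

    -- Rotation by `r` is undone by rotation by `r * m`, because `r + r * m` is a multiple of the
    -- period `suc m`.
    ⊑-rotate : ∀ {m} r (t : Tour m) → at t ⊑ at (rotate r t)
    ⊑-rotate {m} r t n = n + r * m , inj₁ (lem n , lem (suc n))
      where
      lem : ∀ n → at t n ≡ at t (r + (n + r * m))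
      lem n = trans (sym (periodic* t n r)) (cong (at t)
        (solve 3 (λ n r m → n :+ r :* (con 1 :+ m) := r :+ (n :+ r :* m)) refl n r m))
        where open +-*-Solver

    module _ {m} (t : Tour m) where
      private
        back : ∀ n → at t (suc (suc n * m)) ≡ at t (n * m)
        back n = trans (cong (at t) (ℕₚ.+-comm (suc m) (n * m))) (periodic t (n * m))

      -- m ≡ -1 modulo the length suc m.
      reverse : Tour m
      reverse = record
        { at       = λ n → at t (n * m)
        ; step     = λ n → adjacent-sym (subst (Adjacent (at t (suc n * m))) (back n)
                                               (step t (suc n * m)))
        ; periodic = λ n → trans (cong (at t) (trans (ℕₚ.*-distribʳ-+ m n (suc m))
                                   (cong (n * m +_) (ℕₚ.*-comm (suc m) m))))
                                 (periodic* t (n * m) m)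
        ; apart    = λ n d 0<d d<k eq → apart t ((n + d) * m) d 0<d d<k
                       (trans (sym eq) (trans (sym (periodic* t (n * m) d)) (cong (at t)
                         (solve 3 (λ n d m → n :* m :+ d :* (con 1 :+ m)
                                           := (n :+ d) :* m :+ d) refl n d m))))
        }
        where open +-*-Solver

      reverse-⊑ : at reverse ⊑ at t
      reverse-⊑ n = suc n * m , inj₂ (sym (back n) , refl)

    -- Modulo `suc m` the factor `m` is its own inverse. Adding the multiple `n * suc m` of the
    -- period first lets the identity be stated without subtraction.
    reverse-reverse : ∀ {m} (t : Tour m) → at (reverse (reverse t)) ≗ at t
    reverse-reverse {m} t n = begin
      at t (n * m * m)                ≡⟨ periodic* t _ n ⟨
      at t (n * m * m + n * suc m)    ≡⟨ cong (at t) (solve 2 (λ n m →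
        n :* m :* m :+ n :* (con 1 :+ m) := n :+ n :* m :* (con 1 :+ m)) refl n m) ⟩
      at t (n + n * m * suc m)        ≡⟨ periodic* t n (n * m) ⟩
      at t n                          ∎
      where
      open ≡-Reasoning
      open +-*-Solver

    ⊑-reverse : ∀ {m} (t : Tour m) → at t ⊑ at (reverse t)
    ⊑-reverse t =
      ⊑-trans (≗⇒⊑ (sym ∘ reverse-reverse t)) (reverse-⊑ (reverse t))

    -- The normal form of a traversal.

    record Canonical {m} (t : Tour (suc m)) : Set where
      field
        first-least : ∀ n → 0 < n → n < 2 + m → at t 0 Fin.< at t n
        oriented    : at t 1 Fin.< at t (suc m)

    -- Rotating to the least vertex over one period puts it first. Reversal keeps it there and
    -- exchanges the second vertex with the last; these two differ because the length is at least 3,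
    -- so exactly one direction is oriented as required.
    canonical : ∀ {m} (t : Tour (2 + m)) →
                ∃ λ t′ → Canonical t′ × at t′ ⊑ at t × at t ⊑ at t′
    canonical {m} t with argmin (toℕ ∘ at t) (2 + m)
    ... | r , least = orient (ℕₚ.<-cmp (toℕ (at s 1)) (toℕ (at s (2 + m))))
      where
      s = rotate r t
      s-first : ∀ n → 0 < n → n < 3 + m → at s 0 Fin.< at s n
      s-first n 0<n n<k = ℕₚ.≤∧≢⇒<
        -- Periodicity brings the index `r + n` into the range over which `argmin` minimised.
        (subst₂ _≤_ (cong (toℕ ∘ at t) (sym (ℕₚ.+-identityʳ r))) (cong toℕ (at-% t (r + n)))
          (least ((r + n) % (3 + m)) (ℕₚ.≤-pred (m%n<n (r + n) (3 + m)))))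
        (apart s 0 n 0<n n<k ∘ Finₚ.toℕ-injective)
      orient : _ → _
      orient (tri< lt _ _) =
        s , record { first-least = s-first ; oriented = lt } , rotate-⊑ r t , ⊑-rotate r t
      orient (tri≈ _ eq _) = contradiction (Finₚ.toℕ-injective eq)
        (apart s 1 (suc m) (s≤s z≤n) (s≤s (s≤s (ℕₚ.n≤1+n m))))
      orient (tri> _ _ gt) =
        reverse s
        , record
          { first-least = λ n 0<n n<k → subst (at s 0 Fin.<_)
              (at-% s (n * (2 + m)))
              (s-first _ (ℕₚ.n≢0⇒n>0 (rev≢0 n 0<n n<k)) (m%n<n (n * (2 + m)) (3 + m)))
          ; oriented = subst₂ (λ i v → at s i Fin.< v) (sym (ℕₚ.*-identityˡ (2 + m)))
              (sym reverse-reverse′) gt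
          }
        , ⊑-trans (reverse-⊑ s) (rotate-⊑ r t)
        , ⊑-trans (⊑-rotate r t) (⊑-reverse s)
        where
        rev≢0 : ∀ n → 0 < n → n < 3 + m → n * (2 + m) % (3 + m) ≢ 0
        rev≢0 n 0<n n<k eq = apart (reverse s) 0 n 0<n n<k
          (trans (cong (at s) (sym eq)) (at-% s (n * (2 + m))))
        reverse-reverse′ : at (reverse s) (2 + m) ≡ at s 1
        reverse-reverse′ =
          trans (cong (λ x → at s (x * (2 + m))) (sym (ℕₚ.*-identityˡ (2 + m))))
                (reverse-reverse s 1)

    -- Exhaustive listing of normal forms.

    private
      open DecMembership (Finₚ._≟_ {order}) using (_∉?_)

      adjacent? : ∀ u v → Dec (Adjacent u v)
      adjacent? u v = adj u v Bool.≟ true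

    -- Completions of a path s, t, …, u, visiting the vertices vis after s, by n
    -- further vertices to a cycle whose least vertex is s and whose last vertex
    -- is greater than t.
    completions : (s t : Vertex) (n : ℕ) (u : Vertex) → List Vertex → List (Vec Vertex n)
    completions s t zero    u vis =
      filter (λ _ → adjacent? u s ×-dec (t Finₚ.<? u)) ([] ∷ [])
    completions s t (suc n) u vis =
      concatMap (λ v → map (v ∷_) (completions s t n v (v ∷ vis)))
        (filter (λ v → adjacent? u v ×-dec (s Finₚ.<? v) ×-dec (v ∉? vis)) (allFin order))

    canonicalCycles : ∀ m → List (Vec Vertex (2 + m))
    canonicalCycles m =
      concatMap (λ s →
        concatMap (λ t → map (λ xs → s ∷ t ∷ xs) (completions s t m t (t ∷ [])))
          (filter (λ t → adjacent? s t ×-dec (s Finₚ.<? t)) (allFin order)))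
        (allFin order)

    private
      ∈-concatMap-∋ : ∀ {A B : Set} {x xs} {y : B} (f : A → List B) →
                      x ∈ xs → y ∈ f x → y ∈ concatMap f xs
      ∈-concatMap-∋ f x∈ y∈ = ∈-concatMap⁺ f (Any.map (λ { refl → y∈ }) x∈)

    module _ {m} {t : Tour (2 + m)} (can : Canonical t) where
      open Canonical can

      -- Induction along the tour: the path has reached index `i`, and every vertex in `vis` has an
      -- index `j` with `0 < j ≤ i`. A vertex of `vis` met again at `suc i` would contradict
      -- `apart`; the starting vertex is excluded by the comparison `first-least`.
      segment∈completions : ∀ n i vis → suc i + n ≡ 3 + m →
        All (λ v → ∃ λ j → 0 < j × j ≤ i × v ≡ at t j) vis →
        segment (at t) (suc i) n ∈ completions (at t 0) (at t 1) n (at t i) vis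
      segment∈completions zero i vis i+n≡k _ =
        ∈-filter⁺ (λ _ → adjacent? (at t i) (at t 0) ×-dec (at t 1 Finₚ.<? at t i)) (here refl)
          -- Nothing remains to be added, so `suc i` is the full length: the next step returns to
          -- the start by periodicity, and `i` is the index of the last vertex.
          ( subst (Adjacent (at t i)) (trans (cong (at t) i≡) (periodic t 0)) (step t i)
          , subst (λ x → at t 1 Fin.< at t x) (sym (ℕₚ.suc-injective i≡)) oriented)
        where
        i≡ : suc i ≡ 3 + m
        i≡ = trans (sym (ℕₚ.+-identityʳ (suc i))) i+n≡k
      segment∈completions (suc n) i vis i+n≡k visited =
        ∈-concatMap-∋ _
          (∈-filter⁺ _ (∈-allFin (at t (suc i)))
            ( step t i
            , first-least (suc i) (s≤s z≤n) i<k
            , All¬⇒¬Any (All.map fresh visited)))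
          (∈-map⁺ _ (segment∈completions n (suc i) _ (trans (sym (ℕₚ.+-suc (suc i) n)) i+n≡k)
            ((suc i , s≤s z≤n , ℕₚ.≤-refl , refl)
              ∷ All.map (λ (j , 0<j , j≤i , eq) → j , 0<j , ℕₚ.m≤n⇒m≤1+n j≤i , eq) visited)))
        where
        i<k : suc i < 3 + m
        i<k = subst (suc i <_) i+n≡k (ℕₚ.m<m+n (suc i) (s≤s z≤n))
        fresh : ∀ {v} → (∃ λ j → 0 < j × j ≤ i × v ≡ at t j) → at t (suc i) ≢ v
        fresh (j , _ , j≤i , refl) eq with ℕₚ.m≤n⇒∃[o]m+o≡n j≤i
        ... | d , refl = apart t j (suc d) (s≤s z≤n)
          (ℕₚ.≤-<-trans (s≤s (ℕₚ.m≤n+m d j)) i<k)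
          (trans (sym eq) (cong (at t) (sym (ℕₚ.+-suc j d))))

      -- Completeness of the listing holds for every graph. That the listed vectors are cycles, and
      -- distinct ones, is instead decided by evaluation for each concrete graph through `Counted`.
      segment∈canonicalCycles : segment (at t) 0 (3 + m) ∈ canonicalCycles (suc m)
      segment∈canonicalCycles =
        ∈-concatMap-∋ _ (∈-allFin (at t 0))
          (∈-concatMap-∋ _
            (∈-filter⁺ _ (∈-allFin (at t 1))
              (step t 0 , first-least 1 (s≤s z≤n) (s≤s (s≤s z≤n))))
            (∈-map⁺ _ (segment∈completions (suc m) 1 _ refl
              ((1 , s≤s z≤n , s≤s z≤n , refl) ∷ []))))

  -- Cycle counts from a checked list.

  module _ (G : Graph) where
    open Graph G
    open Cycles G

    IsCycle : ∀ {k} → Vec Vertex k → Set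
    IsCycle xs = (∀ i j → lookup xs i ≡ lookup xs j → i ≡ j) ×
                 (∀ i → Adjacent (lookup xs i) (lookup xs (next i)))

    -- This distinguishes the cycles of a subdivision, which are determined by
    -- their vertices.
    Separated : ∀ {k} → Vec Vertex k → Vec Vertex k → Set
    Separated xs ys = ∃ λ i → ∀ j → lookup xs i ≢ lookup ys j

    PairwiseSeparatedCycles : ∀ {k} → List (Vec Vertex k) → Set
    PairwiseSeparatedCycles L =
      (∀ i → IsCycle (List.lookup L i)) ×
      (∀ i j → i ≡ j ⊎ Separated (List.lookup L i) (List.lookup L j))

    isCycle? : ∀ {k} (xs : Vec Vertex k) → Dec (IsCycle xs)
    isCycle? xs =
      Finₚ.all? (λ i → Finₚ.all? λ j → (lookup xs i Finₚ.≟ lookup xs j) →-dec (i Finₚ.≟ j))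
      ×-dec Finₚ.all? (λ i → adj (lookup xs i) (lookup xs (next i)) Bool.≟ true)

    separated? : ∀ {k} (xs ys : Vec Vertex k) → Dec (Separated xs ys)
    separated? xs ys = Finₚ.any? λ i → Finₚ.all? λ j → ¬? (lookup xs i Finₚ.≟ lookup ys j)

    pairwiseSeparatedCycles? : ∀ {k} (L : List (Vec Vertex k)) → Dec (PairwiseSeparatedCycles L)
    pairwiseSeparatedCycles? L =
      Finₚ.all? (λ i → isCycle? (List.lookup L i))
      ×-dec Finₚ.all? λ i → Finₚ.all? λ j →
        (i Finₚ.≟ j) ⊎-dec separated? (List.lookup L i) (List.lookup L j)

    Counted : ℕ → ℕ → Set
    Counted m N = let L = canonicalCycles (suc m) in length L ≡ N × PairwiseSeparatedCycles L

    -- Bound by the λ, the list is evaluated only once.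
    counted? : ∀ m N → Dec (Counted m N)
    counted? m N =
      (λ L → (length L ℕₚ.≟ N) ×-dec pairwiseSeparatedCycles? L) (canonicalCycles (suc m))

    -- Injectivity: an edge leaving a vertex that separates two listed cycles cannot lie on the
    -- second one. Surjectivity: the canonical tour of any cycle is listed and passes the same
    -- edges.
    cycleCount : ∀ m {N} → Counted m N → CycleCount G (3 + m) N
    cycleCount m (refl , isCycle , separated) = record
      { to        = cycle
      ; cong      = λ { refl u v → Setoid.refl (cycleSetoid G (3 + m)) {x = cycle _} u v }
      ; bijective = (λ {i} {j} → cycle-injective i j) , cycle-surjective
      }
      where
      L = canonicalCycles (suc m)

      cycle : Fin (length L) → Cycle G (3 + m)
      cycle i = record
        { 3≤k       = s≤s (s≤s (s≤s z≤n))
        ; vertex    = lookup (List.lookup L i)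
        ; injective = proj₁ (isCycle i) _ _
        ; adjacent  = proj₂ (isCycle i)
        }

      cycle-injective : ∀ i j → SameCycle (cycle i) (cycle j) → i ≡ j
      cycle-injective i j same with separated i j
      ... | inj₁ i≡j           = i≡j
      ... | inj₂ (l , differs) with Equivalence.to (same _ _) (l , inj₁ (refl , refl))
      ...   | n , inj₁ (eq , _) = contradiction eq (differs n)
      ...   | n , inj₂ (_ , eq) = contradiction eq (differs (next n))

      cycle-surjective : ∀ c → ∃ λ i → ∀ {j} → j ≡ i → SameCycle (cycle j) c
      cycle-surjective c with canonical (tour c)
      ... | t , can , t⊑c , c⊑t = i , λ { refl →
        ⊑⇒SameCycle (cycle i) c (⊑-trans (≗⇒⊑ i≗t) t⊑c) (⊑-trans c⊑t (≗⇒⊑ (sym ∘ i≗t))) }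
        where
        open Tour
        t∈L = segment∈canonicalCycles can
        i = index t∈L
        i≗t : at (tour (cycle i)) ≗ at t
        i≗t n = begin
          lookup (List.lookup L i) (n mod (3 + m))
            ≡⟨ cong (λ xs → lookup xs (n mod (3 + m))) (lookup-index t∈L) ⟨
          lookup (segment (at t) 0 (3 + m)) (n mod (3 + m))
            ≡⟨ lookup-segment (at t) 0 (n mod (3 + m)) ⟩
          at t (toℕ (n mod (3 + m)))  ≡⟨ cong (at t) (toℕ-mod n (2 + m)) ⟩
          at t (n % (3 + m))          ≡⟨ at-% t n ⟩
          at t n                      ∎
          where open ≡-Reasoning

  -- Subdivisions of multigraphs.

  module Subdivision {n m : ℕ} (ends : Vec (Fin n × Fin n) m) where

    isEnd : Fin n → Fin m → Bool
    isEnd i e = does (i Finₚ.≟ proj₁ (lookup ends e)) ∨ does (i Finₚ.≟ proj₂ (lookup ends e))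

    -- Each edge of the multigraph becomes a vertex of its own, identified by its index, so parallel
    -- edges stay distinct and the resulting graph is simple.
    incident : Fin n ⊎ Fin m → Fin n ⊎ Fin m → Bool
    incident (inj₁ i) (inj₂ e) = isEnd i e
    incident (inj₂ e) (inj₁ i) = isEnd i e
    incident _        _        = false

    incident-sym : ∀ x y → incident x y ≡ incident y x
    incident-sym (inj₁ _) (inj₁ _) = refl
    incident-sym (inj₁ _) (inj₂ _) = refl
    incident-sym (inj₂ _) (inj₁ _) = refl
    incident-sym (inj₂ _) (inj₂ _) = refl

    incident-irrefl : ∀ x → incident x x ≡ false
    incident-irrefl (inj₁ _) = refl
    incident-irrefl (inj₂ _) = refl

    sideOf : Fin n ⊎ Fin m → Side
    sideOf (inj₁ _) = right
    sideOf (inj₂ _) = left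

    incident-bipartite : ∀ x y → incident x y ≡ true → sideOf x ≢ sideOf y
    incident-bipartite (inj₁ _) (inj₂ _) _ ()
    incident-bipartite (inj₂ _) (inj₁ _) _ ()

    bipartiteGraph : BipartiteGraph
    bipartiteGraph = record
      { graph = record
        { order  = n + m
        ; adj    = λ u v → incident (splitAt n u) (splitAt n v)
        ; symm   = λ u v → incident-sym (splitAt n u) (splitAt n v)
        ; irrefl = λ v → incident-irrefl (splitAt n v)
        }
      ; side      = sideOf ∘ splitAt n
      ; bipartite = λ u v → incident-bipartite (splitAt n u) (splitAt n v)
      }

  -- Girth and regularity of bipartite graphs.

  module _ (B : BipartiteGraph) where
    open BipartiteGraph B hiding (graph)

    bipartite⇒no-triangle : ¬ Cycle (graph B) 3
    bipartite⇒no-triangle c =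
      three (side (vertex zero)) (side (vertex (suc zero))) (side (vertex (suc (suc zero))))
        (bipartite _ _ (adjacent zero)) (bipartite _ _ (adjacent (suc zero)))
        (bipartite _ _ (adjacent (suc (suc zero))))
      where
      open Cycle c
      three : ∀ a b c → a ≢ b → b ≢ c → ¬ (c ≢ a)
      three left  left  _     p _ _ = p refl
      three left  right right _ q _ = q refl
      three left  right left  _ _ r = r refl
      three right right _     p _ _ = p refl
      three right left  left  _ q _ = q refl
      three right left  right _ _ r = r refl

    4-cycle⇒girth : Cycle (graph B) 4 → Girth (graph B) 4
    4-cycle⇒girth c = c , λ k d → ℕₚ.≤∧≢⇒< (Cycle.3≤k d)
      λ { refl → bipartite⇒no-triangle d }

    regularOn? : ∀ s → Dec (RegularOn s)
    regularOn? s = Finₚ.all? λ u → Finₚ.all? λ v →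
      (side u ≟ˢ s) →-dec (side v ≟ˢ s) →-dec (degree u ℕₚ.≟ degree v)

-- Conjugate matrices

module Conjugation where
  open RealNumbers using (ℝ; fromℚ; _≈_; _+_; _*_; 0ℝ; 1ℝ; ℝ-commutativeRing; ≗⇒≈)
  open CommutativeRing ℝ-commutativeRing
    using ( +-cong; *-congˡ; *-congʳ; *-assoc; *-comm; *-identityˡ; +-identityʳ
          ; zeroˡ; zeroʳ; refl; reflexive; sym; trans; setoid)
  open SemiringSum (CommutativeRing.semiring ℝ-commutativeRing)
    using ( sum; sum-syntax; sum-cong-≋; sum-remove; sum-replicate-zero; ∑-comm
          ; *-distribˡ-sum; *-distribʳ-sum)
  open SemiringSum (CommutativeRing.semiring ℤₚ.+-*-commutativeRing)
    using () renaming (sum to sumℤ)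

  -- Eigenspaces under conjugation by an involution.

  infixr 7 _·_
  _·_ : ∀ {n} → Matrix n → Vector ℝ n → Vector ℝ n
  _·_ {n} A v i = ∑[ j < n ] (A i j * v j)

  module _ {n : ℕ} where
    infix 4 _≋_
    _≋_ : Vector ℝ n → Vector ℝ n → Set
    u ≋ v = ∀ i → u i ≈ v i

    ·-cong : ∀ (A : Matrix n) {u v} → u ≋ v → A · u ≋ A · v
    ·-cong A u≋v i = sum-cong-≋ λ j → *-congˡ (u≋v j)

    ·-scale : ∀ (A : Matrix n) x v → A · (λ j → x * v j) ≋ (λ i → x * (A · v) i)
    ·-scale A x v i = begin
      ∑[ j < n ] (A i j * (x * v j))  ≈⟨ sum-cong-≋ (λ j → exchange (A i j) x (v j)) ⟩
      ∑[ j < n ] (x * (A i j * v j))  ≈⟨ *-distribˡ-sum x (λ j → A i j * v j) ⟨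
      x * (A · v) i                   ∎
      where
      open SetoidReasoning setoid
      exchange : ∀ a b c → a * (b * c) ≈ b * (a * c)
      exchange a b c = trans (sym (*-assoc a b c)) (trans (*-congʳ (*-comm a b)) (*-assoc b a c))

    ·-sum : ∀ (A : Matrix n) {m} (c : Vector ℝ m) (b : Vector (Vector ℝ n) m) →
            A · (λ j → ∑[ k < m ] (c k * b k j)) ≋ (λ i → ∑[ k < m ] (c k * (A · b k) i))
    ·-sum A {m} c b i = begin
      ∑[ j < n ] (A i j * ∑[ k < m ] (c k * b k j))
        ≈⟨ sum-cong-≋ (λ j → *-distribˡ-sum (A i j) (λ k → c k * b k j)) ⟩
      ∑[ j < n ] ∑[ k < m ] (A i j * (c k * b k j))
        ≈⟨ ∑-comm (λ j k → A i j * (c k * b k j)) ⟩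
      ∑[ k < m ] ∑[ j < n ] (A i j * (c k * b k j))
        ≈⟨ sum-cong-≋ (λ k → ·-scale A (c k) (b k) i) ⟩
      ∑[ k < m ] (c k * (A · b k) i)  ∎
      where open SetoidReasoning setoid

    ·-zero : ∀ (A : Matrix n) {v} → (∀ j → v j ≈ 0ℝ) → ∀ i → (A · v) i ≈ 0ℝ
    ·-zero A v≈0 i = trans (sum-cong-≋ λ j → trans (*-congˡ (v≈0 j)) (zeroʳ (A i j)))
                           (sum-replicate-zero n)

    ·-assoc : ∀ (A B : Matrix n) v → A · B · v ≋ (λ i k → ∑[ j < n ] (A i j * B j k)) · v
    ·-assoc A B v i = begin
      ∑[ j < n ] (A i j * ∑[ k < n ] (B j k * v k))
        ≈⟨ sum-cong-≋ (λ j → trans (*-distribˡ-sum (A i j) (λ k → B j k * v k))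
             (sum-cong-≋ λ k → sym (*-assoc (A i j) (B j k) (v k)))) ⟩
      ∑[ j < n ] ∑[ k < n ] (A i j * B j k * v k)
        ≈⟨ ∑-comm (λ j k → A i j * B j k * v k) ⟩
      ∑[ k < n ] ∑[ j < n ] (A i j * B j k * v k)
        ≈⟨ sum-cong-≋ (λ k → sym (*-distribʳ-sum (v k) (λ j → A i j * B j k))) ⟩
      ∑[ k < n ] (∑[ j < n ] (A i j * B j k) * v k)  ∎
      where open SetoidReasoning setoid

    ·-congˡ : ∀ {A B : Matrix n} → (∀ i j → A i j ≈ B i j) → ∀ v → A · v ≋ B · v
    ·-congˡ A≈B v i = sum-cong-≋ λ j → *-congʳ (A≈B i j)

    -- For an involution `T` this is the conjugacy A = TBT, written as an identity of operators.
    Intertwines : (T A B : Matrix n) → Set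
    Intertwines T A B = ∀ v → A · T · v ≋ T · B · v

    module _ (T : Matrix n) (involutive : ∀ v → T · T · v ≋ v) where

      Intertwines-sym : ∀ A B → Intertwines T A B → Intertwines T B A
      Intertwines-sym A B intertwines v i = begin
        (B · T · v) i          ≈⟨ involutive (B · T · v) i ⟨
        (T · T · B · T · v) i  ≈⟨ ·-cong T (intertwines (T · v)) i ⟨
        (T · A · T · T · v) i  ≈⟨ ·-cong T (·-cong A (involutive v)) i ⟩
        (T · A · v) i          ∎
        where open SetoidReasoning setoid

      conjugate-eigenvector : ∀ A B → Intertwines T A B →
        ∀ {x v} → InEigenspace B x v → InEigenspace A x (T · v)
      conjugate-eigenvector A B intertwines {x} {v} Bv i = begin
        (A · T · v) i            ≈⟨ intertwines v i ⟩
        (T · B · v) i            ≈⟨ ·-cong T Bv i ⟩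
        (T · (λ j → x * v j)) i  ≈⟨ ·-scale T x v i ⟩
        x * (T · v) i            ∎
        where open SetoidReasoning setoid

      -- `T` maps the eigenspace of `B` into that of `A` and, by `Intertwines-sym`, also back. Being
      -- its own inverse, it carries a basis to a basis: applying it once more reduces both
      -- independence and spanning to the given basis.
      conjugate-multiplicity : ∀ A B → Intertwines T A B →
        ∀ {x m} → EigenvalueMultiplicity B x m → EigenvalueMultiplicity A x m
      conjugate-multiplicity A B intertwines {x} {m} mult = record
        { basis       = λ k → T · basis k
        ; eigen       = λ k → conjugate-eigenvector A B intertwines (eigen k)
        ; independent = λ c c·Tb≈0 → independent c λ i → begin
            ∑[ k < m ] (c k * basis k i)
              ≈⟨ involutive (λ i → ∑[ k < m ] (c k * basis k i)) i ⟨
            (T · T · (λ i → ∑[ k < m ] (c k * basis k i))) i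
              ≈⟨ ·-zero T (λ j → trans (·-sum T c basis j) (c·Tb≈0 j)) i ⟩
            0ℝ  ∎
        ; spanning    = λ v Av →
            let (c , Tv) = spanning (T · v)
                             (conjugate-eigenvector B A (Intertwines-sym A B intertwines) Av)
            in c , λ i → begin
              v i                                           ≈⟨ involutive v i ⟨
              (T · T · v) i                                 ≈⟨ ·-cong T Tv i ⟩
              (T · (λ j → ∑[ k < m ] (c k * basis k j))) i  ≈⟨ ·-sum T c basis i ⟩
              ∑[ k < m ] (c k * (T · basis k) i)            ∎
        }
        where
        open EigenvalueMultiplicity mult
        open SetoidReasoning setoid

  -- Integer matrices as real matrices.

  fromℤ : ℤ → ℝ
  fromℤ z = fromℚ (z ℚ./ 1)

  -- The normalisation inside `ℚ./` is stuck on a variable integer. Among unnormalised rationals the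
  -- identity is a cross multiplication.
  /1-+ : ∀ y z → (y ℤ.+ z) ℚ./ 1 ≡ y ℚ./ 1 ℚ.+ z ℚ./ 1
  /1-+ y z = ℚₚ.toℚᵘ-injective (begin
    ℚ.toℚᵘ ((y ℤ.+ z) ℚ./ 1)
      ≈⟨ ℚₚ.toℚᵘ-fromℚᵘ (ℚᵘ.mkℚᵘ (y ℤ.+ z) 0) ⟩
    ℚᵘ.mkℚᵘ (y ℤ.+ z) 0
      ≈⟨ ℚᵘ.*≡* (cong (ℤ._* 1ℤ)
           (≡.cong₂ ℤ._+_ (≡.sym (ℤₚ.*-identityʳ y)) (≡.sym (ℤₚ.*-identityʳ z)))) ⟩
    ℚᵘ.mkℚᵘ y 0 ℚᵘ.+ ℚᵘ.mkℚᵘ z 0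
      ≈⟨ ℚᵘₚ.+-cong (ℚₚ.toℚᵘ-fromℚᵘ (ℚᵘ.mkℚᵘ y 0)) (ℚₚ.toℚᵘ-fromℚᵘ (ℚᵘ.mkℚᵘ z 0)) ⟨
    ℚ.toℚᵘ (y ℚ./ 1) ℚᵘ.+ ℚ.toℚᵘ (z ℚ./ 1)
      ≈⟨ ℚₚ.toℚᵘ-homo-+ (y ℚ./ 1) (z ℚ./ 1) ⟨
    ℚ.toℚᵘ (y ℚ./ 1 ℚ.+ z ℚ./ 1)  ∎)
    where open SetoidReasoning ℚᵘₚ.≃-setoid

  /1-* : ∀ y z → (y ℤ.* z) ℚ./ 1 ≡ y ℚ./ 1 ℚ.* (z ℚ./ 1)
  /1-* y z = ℚₚ.toℚᵘ-injective (begin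
    ℚ.toℚᵘ ((y ℤ.* z) ℚ./ 1)
      ≈⟨ ℚₚ.toℚᵘ-fromℚᵘ (ℚᵘ.mkℚᵘ (y ℤ.* z) 0) ⟩
    ℚᵘ.mkℚᵘ y 0 ℚᵘ.* ℚᵘ.mkℚᵘ z 0
      ≈⟨ ℚᵘₚ.*-cong (ℚₚ.toℚᵘ-fromℚᵘ (ℚᵘ.mkℚᵘ y 0)) (ℚₚ.toℚᵘ-fromℚᵘ (ℚᵘ.mkℚᵘ z 0)) ⟨
    ℚ.toℚᵘ (y ℚ./ 1) ℚᵘ.* ℚ.toℚᵘ (z ℚ./ 1)
      ≈⟨ ℚₚ.toℚᵘ-homo-* (y ℚ./ 1) (z ℚ./ 1) ⟨
    ℚ.toℚᵘ (y ℚ./ 1 ℚ.* (z ℚ./ 1))  ∎)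
    where open SetoidReasoning ℚᵘₚ.≃-setoid

  fromℤ-+ : ∀ y z → fromℤ (y ℤ.+ z) ≈ fromℤ y + fromℤ z
  fromℤ-+ y z = ≗⇒≈ λ _ → /1-+ y z

  fromℤ-* : ∀ y z → fromℤ (y ℤ.* z) ≈ fromℤ y * fromℤ z
  fromℤ-* y z = ≗⇒≈ λ _ → /1-* y z

  fromℤ-sum : ∀ {n} (f : Vector ℤ n) → fromℤ (sumℤ f) ≈ sum (fromℤ ∘ f)
  fromℤ-sum {zero}  f = ≗⇒≈ λ _ → ≡.refl
  fromℤ-sum {suc n} f = trans (fromℤ-+ (f zero) (sumℤ (f ∘ suc))) (+-cong refl (fromℤ-sum (f ∘ suc)))

  integral : ∀ {n} → (Fin n → Fin n → ℤ) → Matrix n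
  integral a i j = fromℤ (a i j)

  integral-cong : ∀ {n} {a b : Fin n → Fin n → ℤ} → (∀ i j → a i j ≡ b i j) →
                  ∀ i j → integral a i j ≈ integral b i j
  integral-cong eq i j = reflexive (cong fromℤ (eq i j))

  infixl 7 _⊗_
  _⊗_ : ∀ {n} → (Fin n → Fin n → ℤ) → (Fin n → Fin n → ℤ) → Fin n → Fin n → ℤ
  (a ⊗ b) i k = sumℤ λ j → a i j ℤ.* b j k

  -- This transfers matrix identities from the integers, where they are decided entry by entry, to
  -- operators on real vectors.
  integral-⊗ : ∀ {n} (a b : Fin n → Fin n → ℤ) v →
               integral a · integral b · v ≋ integral (a ⊗ b) · v
  integral-⊗ {n} a b v i = trans (·-assoc (integral a) (integral b) v i)
    (sum-cong-≋ λ k → *-congʳ (sym (trans (fromℤ-sum (λ j → a i j ℤ.* b j k))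
      (sum-cong-≋ λ j → fromℤ-* (a i j) (b j k)))))

  scalar : ∀ {n} → ℤ → Fin n → Fin n → ℤ
  scalar z i j = if does (i Finₚ.≟ j) then z else 0ℤ

  scalar-· : ∀ {n} z (v : Vector ℝ n) → integral (scalar z) · v ≋ λ i → fromℤ z * v i
  scalar-· {suc n} z v i = begin
    ∑[ j < suc n ] (d i j * v j)
      ≈⟨ sum-remove {i = i} (λ j → d i j * v j) ⟩
    d i i * v i + ∑[ j < n ] (d i (punchIn i j) * v (punchIn i j))
      ≈⟨ +-cong (reflexive (cong entry (dec-true (i Finₚ.≟ i) ≡.refl)))
           (trans (sum-cong-≋ λ j → trans
             (reflexive (cong (λ b → fromℤ (if b then z else 0ℤ) * v (punchIn i j))
               (dec-false (i Finₚ.≟ punchIn i j) (Finₚ.punchInᵢ≢i i j ∘ ≡.sym))))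
             (zeroˡ _)) (sum-replicate-zero n)) ⟩
    fromℤ z * v i + 0ℝ  ≈⟨ +-identityʳ _ ⟩
    fromℤ z * v i       ∎
    where
    open SetoidReasoning setoid
    d = integral (scalar z)
    entry = λ b → fromℤ (if b then z else 0ℤ) * v i

  -- Cospectrality from two integer identities.

  module _ {n : ℕ} (a b τ : Fin n → Fin n → ℤ)
           (intertwines : ∀ i j → (a ⊗ τ) i j ≡ (τ ⊗ b) i j)
           (square      : ∀ i j → (τ ⊗ τ) i j ≡ scalar (ℤ.+ 4) i j) where
    private
      -- The matrix `τ` is twice the involution, which makes its entries integers; the factor 2
      -- squared is the 4 in `square`.
      h = fromℚ ½

      T : Matrix n
      T i j = h * integral τ i j

      T-· : ∀ v → T · v ≋ λ i → h * (integral τ · v) i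
      T-· v i = trans (sum-cong-≋ λ j → *-assoc h (integral τ i j) (v j))
                      (sym (*-distribˡ-sum h (λ j → integral τ i j * v j)))

      T-involutive : ∀ v → T · T · v ≋ v
      T-involutive v i = begin
        (T · T · v) i
          ≈⟨ T-· (T · v) i ⟩
        h * (integral τ · T · v) i
          ≈⟨ *-congˡ (·-cong (integral τ) (T-· v) i) ⟩
        h * (integral τ · (λ j → h * (integral τ · v) j)) i
          ≈⟨ *-congˡ (·-scale (integral τ) h (integral τ · v) i) ⟩
        h * (h * (integral τ · integral τ · v) i)
          ≈⟨ *-congˡ (*-congˡ (integral-⊗ τ τ v i)) ⟩
        h * (h * (integral (τ ⊗ τ) · v) i)
          ≈⟨ *-congˡ (*-congˡ (·-congˡ (integral-cong square) v i)) ⟩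
        h * (h * (integral (scalar (ℤ.+ 4)) · v) i)
          ≈⟨ *-congˡ (*-congˡ (scalar-· (ℤ.+ 4) v i)) ⟩
        h * (h * (fromℤ (ℤ.+ 4) * v i))
          ≈⟨ *-congˡ (*-assoc h (fromℤ (ℤ.+ 4)) (v i)) ⟨
        h * (h * fromℤ (ℤ.+ 4) * v i)
          ≈⟨ *-assoc h (h * fromℤ (ℤ.+ 4)) (v i) ⟨
        h * (h * fromℤ (ℤ.+ 4)) * v i
          -- The constant ½ · (½ · 4) evaluates to 1.
          ≈⟨ *-congʳ (≗⇒≈ λ _ → ≡.refl) ⟩
        1ℝ * v i
          ≈⟨ *-identityˡ (v i) ⟩
        v i  ∎
        where open SetoidReasoning setoid

    module _ {A B : Matrix n}
             (A≈a : ∀ i j → A i j ≈ integral a i j) (B≈b : ∀ i j → B i j ≈ integral b i j) where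
      private
        T-intertwines : Intertwines T A B
        T-intertwines v i = begin
          (A · T · v) i
            ≈⟨ ·-congˡ A≈a (T · v) i ⟩
          (integral a · T · v) i
            ≈⟨ ·-cong (integral a) (T-· v) i ⟩
          (integral a · (λ j → h * (integral τ · v) j)) i
            ≈⟨ ·-scale (integral a) h (integral τ · v) i ⟩
          h * (integral a · integral τ · v) i
            ≈⟨ *-congˡ (integral-⊗ a τ v i) ⟩
          h * (integral (a ⊗ τ) · v) i
            ≈⟨ *-congˡ (·-congˡ (integral-cong intertwines) v i) ⟩
          h * (integral (τ ⊗ b) · v) i
            ≈⟨ *-congˡ (integral-⊗ τ b v i) ⟨
          h * (integral τ · integral b · v) i
            ≈⟨ T-· (integral b · v) i ⟨
          (T · integral b · v) i
            ≈⟨ ·-cong T (·-congˡ B≈b v) i ⟨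
          (T · B · v) i  ∎
          where open SetoidReasoning setoid

      conjugate⇒cospectral : ∀ x m → EigenvalueMultiplicity A x m ⇔ EigenvalueMultiplicity B x m
      conjugate⇒cospectral x m = mk⇔
        (conjugate-multiplicity T T-involutive B A
          (Intertwines-sym T T-involutive A B T-intertwines))
        (conjugate-multiplicity T T-involutive A B T-intertwines)

  adjacencyℤ : ∀ H → Graph.Vertex H → Graph.Vertex H → ℤ
  adjacencyℤ H u v = if Graph.adj H u v then 1ℤ else 0ℤ

  adjacencyMatrix-integral : ∀ H u v → Graph.adjacencyMatrix H u v ≈ integral (adjacencyℤ H) u v
  adjacencyMatrix-integral H u v with Graph.adj H u v
  ... | true  = refl
  ... | false = refl

-- The two graphs

open CycleCounting
open Conjugation

-- Sorted permutations of one list agree, so degree sequences can be compared as unsorted lists.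
sort-cong-↭ : let open Sort (Flip.decTotalOrder ℕₚ.≤-decTotalOrder) in
              ∀ {xs ys} → xs ↭ ys → sort xs ≡ sort ys
sort-cong-↭ {xs} {ys} xs↭ys = Pointwise-≡⇒≡
  (↗↭↗⇒≋ (DecTotalOrder.totalOrder ≥-decTotalOrder) (sort-↗ xs) (sort-↗ ys)
    (↭⇒↭ₛ (↭-trans (sort-↭ xs) (↭-trans xs↭ys (↭-sym (sort-↭ ys))))))
  where
  ≥-decTotalOrder = Flip.decTotalOrder ℕₚ.≤-decTotalOrder
  open Sort ≥-decTotalOrder

-- The first two rows are the two cells of edges. The i-th edge of each ends at the i-th of the
-- nodes 0 to 3, and these perfect matchings between cells survive the conjugation. Every fixed
-- vertex is adjacent to none or exactly two vertices of each cell, and switching replaces two by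
-- the other two: node 4 leaves the first and last edges of the first row for the middle ones, and
-- the edge from 0 to 2 becomes the edge from 1 to 3. The path from 4 to 5 through 7 and 8 is fixed.
ends ends′ : Vec (Fin 9 × Fin 9) 13
ends  = (# 0 , # 4) ∷ (# 1 , # 6) ∷ (# 2 , # 6) ∷ (# 3 , # 4)
      ∷ (# 0 , # 5) ∷ (# 1 , # 6) ∷ (# 2 , # 5) ∷ (# 3 , # 6)
      ∷ (# 0 , # 2) ∷ (# 2 , # 3) ∷ (# 4 , # 7) ∷ (# 7 , # 8) ∷ (# 8 , # 5) ∷ []
ends′ = (# 0 , # 6) ∷ (# 1 , # 4) ∷ (# 2 , # 4) ∷ (# 3 , # 6)
      ∷ (# 0 , # 6) ∷ (# 1 , # 5) ∷ (# 2 , # 6) ∷ (# 3 , # 5)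
      ∷ (# 1 , # 3) ∷ (# 0 , # 1) ∷ (# 4 , # 7) ∷ (# 7 , # 8) ∷ (# 8 , # 5) ∷ []

G G′ : BipartiteGraph
G  = Subdivision.bipartiteGraph ends
G′ = Subdivision.bipartiteGraph ends′

halfRegular : HalfRegular G
halfRegular = (left , from-yes (regularOn? G left)) ,
  -- Nodes 0 and 1 have degrees 3 and 2 here.
  λ regular → contradiction (regular right (# 0) (# 1) ≡.refl ≡.refl) λ ()

halfRegular′ : HalfRegular G′
halfRegular′ = (left , from-yes (regularOn? G′ left)) ,
  -- Here the degrees of nodes 0 and 1 are 3 and 4.
  λ regular → contradiction (regular right (# 0) (# 1) ≡.refl ≡.refl) λ ()

sameDegreeSequences : SameDegreeSequences G G′
sameDegreeSequences left  = sort-cong-↭ ↭-refl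
-- Node degrees begin 3, 2, 4 in `G` and 3, 4, 2 in `G′`, and agree from node 3 on.
sameDegreeSequences right = sort-cong-↭ (prep 3 (swap 2 4 ↭-refl))

-- The cells of the switching are 1, 2 and 3; the vertices in 0 are fixed.
cells : Vec ℕ 22
cells = 1 ∷ 1 ∷ 1 ∷ 1 ∷ 0 ∷ 0 ∷ 0 ∷ 0 ∷ 0
      ∷ 2 ∷ 2 ∷ 2 ∷ 2 ∷ 3 ∷ 3 ∷ 3 ∷ 3 ∷ 0 ∷ 0 ∷ 0 ∷ 0 ∷ 0 ∷ []

-- Twice the involution T.
switching : Fin 22 → Fin 22 → ℤ
switching u v = row (lookup cells u)
  where
  row : ℕ → ℤ
  row zero    = scalar (ℤ.+ 2) u v
  -- On a cell this is J - 2I, whose square is 4I because J² = 4J for cells of four vertices.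
  row (suc c) = (if lookup cells v Nat.≡ᵇ suc c then 1ℤ else 0ℤ) ℤ.- scalar (ℤ.+ 2) u v

sameSpectrum : SameSpectrum (graph G) (graph G′)
sameSpectrum = conjugate⇒cospectral a a′ switching
  (from-yes (Finₚ.all? λ i → Finₚ.all? λ j → (a ⊗ switching) i j ℤ.≟ (switching ⊗ a′) i j))
  (from-yes (Finₚ.all? λ i → Finₚ.all? λ j → (switching ⊗ switching) i j ℤ.≟ scalar (ℤ.+ 4) i j))
  (adjacencyMatrix-integral (graph G)) (adjacencyMatrix-integral (graph G′))
  where
  a  = adjacencyℤ (graph G)
  a′ = adjacencyℤ (graph G′)

-- The parameter 1 stands for length 3 + 1, and a positive count yields a 4-cycle as the image of
-- `zero`.
girth : ∀ B N → True (counted? (graph B) 1 (suc N)) → Girth (graph B) 4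
girth B N p =
  4-cycle⇒girth B (Bijection.to (cycleCount (graph B) 1 (toWitness p)) zero)

DifferentCounts : ℕ → Set
DifferentCounts i = ∃ λ N → ∃ λ N′ →
  CycleCount (graph G) i N × CycleCount (graph G′) i N′ × N ≢ N′

differentCounts : ∀ m N N′ → True (counted? (graph G) m N) → True (counted? (graph G′) m N′) →
                  N ≢ N′ → DifferentCounts (3 Nat.+ m)
differentCounts m N N′ p p′ N≢N′ =
  N , N′ , cycleCount (graph G) m (toWitness p) , cycleCount (graph G′) m (toWitness p′) , N≢N′

allCountsDiffer : All DifferentCounts (6 ∷ 8 ∷ 10 ∷ 12 ∷ 14 ∷ 16 ∷ 18 ∷ [])
allCountsDiffer
  -- The first argument is the cycle length minus 3. The last row counts the Hamiltonian cycles of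
  -- the two multigraphs on nine nodes, 0 and 2.
  = differentCounts 3  2 1 _ _ (λ ())
  ∷ differentCounts 5  1 2 _ _ (λ ())
  ∷ differentCounts 7  3 6 _ _ (λ ())
  ∷ differentCounts 9  3 2 _ _ (λ ())
  ∷ differentCounts 11 2 1 _ _ (λ ())
  ∷ differentCounts 13 1 5 _ _ (λ ())
  ∷ differentCounts 15 0 2 _ _ (λ ())
  ∷ []

mainTheorem3 : ∃ λ (G : BipartiteGraph) → ∃ λ (G′ : BipartiteGraph) →
    HalfRegular G × HalfRegular G′ ×
    SameSpectrum (graph G) (graph G′) ×
    SameDegreeSequences G G′ ×
    Girth (graph G) 4 × Girth (graph G′) 4 ×
    (∀ (i : ℕ) → i ∈ 6 ∷ 8 ∷ 10 ∷ 12 ∷ 14 ∷ 16 ∷ 18 ∷ [] →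
    ∃ λ (N : ℕ) → ∃ λ (N′ : ℕ) →
    CycleCount (graph G) i N × CycleCount (graph G′) i N′ × N ≢ N′)
mainTheorem3 =
  G , G′ , halfRegular , halfRegular′ , sameSpectrum , sameDegreeSequences ,
  girth G 0 _ , girth G′ 0 _ , λ i i∈ → All.lookup allCountsDiffer i∈
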